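{- Let $(\Omega,S)$ be a scheme with $n_s\ge3$ for each $s\in S^\#$. Then $(\Omega,S)$ is the scheme of an affine space if and only if $c_{rs}^t\le1$ for all $r,s,t\in S$ with $r\ne s^*$.
   Context: A scheme on a finite set $\Omega$ is a pair $(\Omega,S)$, $S$ a partition of $\Omega\times\Omega$ containing $1_\Omega$, closed under transposition $s\mapsto s^*$, with intersection numbers $c_{rs}^t=|\{\beta:(\alpha,\beta)\in r,(\beta,\gamma)\in s\}|$ independent of $(\alpha,\gamma)\in t$. $S^\#=S\setminus\{1_\Omega\}$ and $n_s=|\{\beta:(\alpha,\beta)\in s\}|$. The scheme of a finite affine space with point set $\Omega$ is the partition of $\Omega\times\Omega$ having $1_\Omega$ as a class and in which two pairs $(\alpha,\beta),(\alpha',\beta')$ with $\alpha\ne\beta,\alpha'\ne\beta'$ are in the same class iff the lines $\alpha\beta$ and $\alpha'\beta'$ are equal or parallel. -}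

module Defs where

open import Level using (0ℓ) renaming (suc to lsuc)
open import Data.Nat using (ℕ; _≤_)
open import Data.Fin using (Fin; _≟_)
open import Data.List using (length; filter)
open import Data.List.Base using ()
open import Data.Fin.Base using ()
open import Data.Product using (Σ; ∃; _×_; _,_)
open import Relation.Nullary using (¬_)
open import Relation.Nullary.Decidable using (_×-dec_)
open import Relation.Binary.PropositionalEquality using (_≡_; _≢_)
open import Function.Bundles using (_⇔_)
open import Data.List using (List)
open import Data.Fin using () renaming (zero to fz)

open import Data.List.Base using (allFin)

-- Schemes on a finite set Ω = Fin N.
-- The partition S of Ω × Ω is given by a surjective colouring
-- col : Ω → Ω → Fin d (the classes are the non-empty fibres of col).

record Scheme (N : ℕ) : Set where
  field
    d        : ℕ
    col      : Fin N → Fin N → Fin d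
    surj     : (s : Fin d) → ∃ λ (p : Σ (Fin N) (λ _ → Fin N)) →
                 let (α , β) = p in col α β ≡ s
    diag     : Fin d
    diag⇒≡   : ∀ α β → col α β ≡ diag → α ≡ β
    ≡⇒diag   : ∀ α → col α α ≡ diag
    star     : Fin d → Fin d
    star-col : ∀ α β → col β α ≡ star (col α β)

  count : Fin d → Fin d → Fin N → Fin N → ℕ
  count r s α γ =
    length (filter (λ β → (col α β ≟ r) ×-dec (col β γ ≟ s)) (allFin N))

  valency : Fin d → Fin N → ℕ
  valency s α = length (filter (λ β → col α β ≟ s) (allFin N))

  field
    regular  : ∀ r s α γ α' γ' → col α γ ≡ col α' γ' →
               count r s α γ ≡ count r s α' γ'

open Scheme public

-- Finite affine spaces (Lenz / Buekenhout axioms) on Ω = Fin N.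

record AffineSpace (N : ℕ) : Set₁ where
  field
    Line   : Set
    _I_    : Fin N → Line → Set
    _∥_    : Line → Line → Set
    join     : (x y : Fin N) → x ≢ y → Line
    join-I₁  : ∀ x y (p : x ≢ y) → x I join x y p
    join-I₂  : ∀ x y (p : x ≢ y) → y I join x y p
    join-uniq : ∀ x y (p : x ≢ y) (l : Line) → x I l → y I l → l ≡ join x y p
    two-points : (l : Line) → ∃ λ x → ∃ λ y → x ≢ y × x I l × y I l
    ∥-refl  : ∀ l → l ∥ l
    ∥-sym   : ∀ l m → l ∥ m → m ∥ l
    ∥-trans : ∀ l m k → l ∥ m → m ∥ k → l ∥ k
    playfair-∃ : ∀ (x : Fin N) (l : Line) → ∃ λ m → x I m × m ∥ l
    playfair-! : ∀ (x : Fin N) (l m m' : Line) →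
                 x I m → m ∥ l → x I m' → m' ∥ l → m ≡ m'
    triangle : ∀ a b c a' b' (ab : a ≢ b) (ac : a ≢ c) (bc : b ≢ c) (ab' : a' ≢ b') →
               ¬ (c I join a b ab) →
               join a b ab ∥ join a' b' ab' →
               ∀ m₁ m₂ → a' I m₁ → m₁ ∥ join a c ac → b' I m₂ → m₂ ∥ join b c bc →
               ∃ λ p → p I m₁ × p I m₂

open AffineSpace public

IsAffineScheme : ∀ {N} → Scheme N → Set₁
IsAffineScheme {N} X =
  Σ (AffineSpace N) λ A →
    ∀ α β α' β' (p : α ≢ β) (p' : α' ≢ β') →
      (col X α β ≡ col X α' β') ⇔ _∥_ A (join A α β p) (join A α' β' p')

SmallIntersections : ∀ {N} → Scheme N → Set
SmallIntersections {N} X =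
  ∀ (r s t : Fin (d X)) → r ≢ star X s →
    ∀ α γ → col X α γ ≡ t → count X r s α γ ≤ 1

ValencyAtLeast3 : ∀ {N} → Scheme N → Set
ValencyAtLeast3 {N} X = ∀ (s : Fin (d X)) → s ≢ diag X → ∀ α → 3 ≤ valency X s α

{-# OPTIONS --safe #-}
-- Smallness of the intersection numbers forbids 4-cycles α, β, γ, β′ with
-- col α β = col α β′ and col β γ = col β′ γ, unless these two colours are
-- transposes of each other.  Hence the sets s* s ∖ {1}, for s ≠ 1, are pairwise
-- disjoint; as they are non-empty subsets of S ∖ {1}, each is a singleton {f s}.
-- If β₁, β₂, β₃ are s-neighbours of α, then β₁, β₂, α, β₃ is such a 4-cycle with
-- colours f s and s*, so f s = s.  Thus every s is symmetric and s ∪ 1 is an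
-- equivalence relation, whose classes are the lines of direction s; the triangle
-- axiom only says that c_{rs}^t does not depend on the pair in t.
module Submission where

open import Defs
open import Axiom.UniquenessOfIdentityProofs using (module Decidable⇒UIP)
open import Data.Nat using (ℕ; suc; _≤_; z≤n; s≤s)
open import Data.Nat.Properties using (1+n≰n; ≤-trans)
open import Data.Fin using (Fin; punchOut; _≟_)
open import Data.Fin.Properties using (any?; injective⇒≤; punchOut-injective)
open import Data.List using (List; []; _∷_; length; filter; allFin; head)
open import Data.List.Properties using (filter-≐)
open import Data.List.Membership.Propositional using (_∈_)
open import Data.List.Membership.Propositional.Properties using (∈-filter⁺; ∈-filter⁻; ∈-allFin)
open import Data.List.Relation.Unary.Any using (here; there)
open import Data.List.Relation.Unary.All using ([]; _∷_)
open import Data.List.Relation.Unary.AllPairs using ([]; _∷_)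
open import Data.List.Relation.Unary.Unique.Propositional using (Unique)
open import Data.List.Relation.Unary.Unique.Propositional.Properties using (filter⁺; allFin⁺)
open import Data.Maybe using (fromMaybe)
open import Data.Product using (∃; ∃₂; _×_; _,_; proj₁; proj₂)
open import Data.Sum using (_⊎_; inj₁; inj₂)
open import Function.Base using (_∘_)
open import Function.Bundles using (_⇔_; mk⇔; Equivalence)
open import Function.Definitions using (Injective)
open import Level using (Level)
open import Relation.Nullary using (¬_; Dec; yes; no; contradiction)
open import Relation.Nullary.Decidable using (_×-dec_; _⊎-dec_; decidable-stable)
open import Relation.Unary using (Pred; Decidable)
open import Relation.Binary.PropositionalEquality

private variable
  a p : Level
  A : Set a
  n : ℕ

-- Short lists, filters over finite sets, and the pigeonhole principle.

Unique-length≤1 : {xs : List A} → Unique xs →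
                  (∀ {x y} → x ∈ xs → y ∈ xs → x ≡ y) → length xs ≤ 1
Unique-length≤1 {xs = []} _ _ = z≤n
Unique-length≤1 {xs = _ ∷ []} _ _ = s≤s z≤n
Unique-length≤1 {xs = _ ∷ _ ∷ _} ((x≢y ∷ _) ∷ _) all≡ =
  contradiction (all≡ (here refl) (there (here refl))) x≢y

length≤1⇒≡ : {xs : List A} → length xs ≤ 1 → ∀ {x y} → x ∈ xs → y ∈ xs → x ≡ y
length≤1⇒≡ {xs = _ ∷ []} _ (here refl) (here refl) = refl
length≤1⇒≡ {xs = _ ∷ _ ∷ _} (s≤s ())

∈⇒1≤length : {xs : List A} → ∀ {x} → x ∈ xs → 1 ≤ length xs
∈⇒1≤length {xs = _ ∷ _} _ = s≤s z≤n

fromMaybe-head-∈ : ∀ {xs : List A} {x} z → x ∈ xs → fromMaybe z (head xs) ∈ xs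
fromMaybe-head-∈ {xs = _ ∷ _} _ _ = here refl

fromMaybe-head-irrelevant : ∀ {xs : List A} {x} y z → x ∈ xs →
                            fromMaybe y (head xs) ≡ fromMaybe z (head xs)
fromMaybe-head-irrelevant {xs = _ ∷ _} _ _ _ = refl

module _ {P : Pred (Fin n) p} (P? : Decidable P) where

  filter-allFin⁺ : ∀ {i} → P i → i ∈ filter P? (allFin n)
  filter-allFin⁺ = ∈-filter⁺ P? (∈-allFin _)

  filter-allFin⁻ : ∀ {i} → i ∈ filter P? (allFin n) → P i
  filter-allFin⁻ = proj₂ ∘ ∈-filter⁻ P? {xs = allFin n}

  1≤length-filter⇒∃ : 1 ≤ length (filter P? (allFin n)) → ∃ P
  1≤length-filter⇒∃ 1≤ with filter P? (allFin n) in eq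
  ... | i ∷ _ = i , filter-allFin⁻ (subst (i ∈_) (sym eq) (here refl))

  3≤length-filter⇒∃₃ : 3 ≤ length (filter P? (allFin n)) →
    ∃ λ i → ∃₂ λ j k → i ≢ j × i ≢ k × j ≢ k × P i × P j × P k
  -- Uniqueness is abstracted along with the filtered list, so that exposing three entries also
  -- exposes their distinctness.
  3≤length-filter⇒∃₃ 3≤ with filter P? (allFin n) in eq | filter⁺ P? (allFin⁺ n)
  3≤length-filter⇒∃₃ (s≤s ()) | _ ∷ [] | _
  3≤length-filter⇒∃₃ (s≤s (s≤s ())) | _ ∷ _ ∷ [] | _
  ... | i ∷ j ∷ k ∷ _ | (i≢j ∷ i≢k ∷ _) ∷ (j≢k ∷ _) ∷ _ =
    i , j , k , i≢j , i≢k , j≢k , P∈ (here refl) , P∈ (there (here refl)) ,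
    P∈ (there (there (here refl)))
    where
    P∈ : ∀ {l} → l ∈ _ → P l
    P∈ {l} l∈ = filter-allFin⁻ (subst (l ∈_) (sym eq) l∈)

-- If `j` were missed, punching it out of the codomain would inject a set into one with one element
-- fewer.
injective⇒surjective : {f : Fin n → Fin n} → Injective _≡_ _≡_ f → ∀ j → ∃ λ i → f i ≡ j
injective⇒surjective {suc n} {f} f-inj j = decidable-stable (any? λ i → f i ≟ j) λ ¬∃ →
  let j≢f : ∀ i → j ≢ f i
      j≢f i eq = ¬∃ (i , sym eq)
  in 1+n≰n (injective⇒≤ {f = λ i → punchOut (j≢f i)}
             (λ {x} {y} → f-inj ∘ punchOut-injective (j≢f x) (j≢f y)))

-- Colours and paths in a scheme.

module _ {N : ℕ} (X : Scheme N) where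

  col≢diag : ∀ {α β} → α ≢ β → col X α β ≢ diag X
  col≢diag α≢β = α≢β ∘ diag⇒≡ X _ _

  ≢diag⇒≢ : ∀ {α β s} → s ≢ diag X → col X α β ≡ s → α ≢ β
  ≢diag⇒≢ s≢1 refl refl = s≢1 (≡⇒diag X _)

  -- The point `β` shows that an intersection number is positive at (`α`, `γ`), hence, by
  -- regularity, at (`α′`, `γ′`).
  transport-path : ∀ {α γ α′ γ′} β → col X α γ ≡ col X α′ γ′ →
    ∃ λ β′ → col X α′ β′ ≡ col X α β × col X β′ γ′ ≡ col X β γ
  transport-path {α} {γ} {α′} {γ′} β αγ≡α′γ′ = 1≤length-filter⇒∃
    (λ β′ → (col X α′ β′ ≟ col X α β) ×-dec (col X β′ γ′ ≟ col X β γ))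
    (subst (1 ≤_) (regular X _ _ α γ α′ γ′ αγ≡α′γ′)
      (∈⇒1≤length (filter-allFin⁺
        (λ β′ → (col X α β′ ≟ col X α β) ×-dec (col X β′ γ ≟ col X β γ))
        (refl , refl))))

  -- Affine schemes have small intersection numbers.

  module AffineToSmall (𝔸 : AffineSpace N)
    (col⇔∥ : ∀ α β α′ β′ (p : α ≢ β) (p′ : α′ ≢ β′) →
      (col X α β ≡ col X α′ β′) ⇔ _∥_ 𝔸 (join 𝔸 α β p) (join 𝔸 α′ β′ p′)) where

    open AffineSpace 𝔸 using () renaming (_I_ to _on_)

    -- Equal colours make the two lines parallel; both pass through `α`, so the uniqueness in
    -- Playfair's axiom identifies them.
    join-equal : ∀ {α β γ} (p : α ≢ β) (q : α ≢ γ) → col X α β ≡ col X α γ →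
                 join 𝔸 α β p ≡ join 𝔸 α γ q
    join-equal {α} {β} {γ} p q eq = playfair-! 𝔸 α (join 𝔸 α γ q) _ _
      (join-I₁ 𝔸 α β p) (Equivalence.to (col⇔∥ _ _ _ _ p q) eq)
      (join-I₁ 𝔸 α γ q) (∥-refl 𝔸 _)

    collinear : ∀ {α β γ} (p : α ≢ β) → β ≢ γ → col X α β ≡ col X α γ → γ on join 𝔸 α β p
    collinear {α} {β} {γ} p β≢γ eq = subst (γ on_) (sym (join-equal p q eq)) (join-I₂ 𝔸 α γ q)
      where
      q : α ≢ γ
      q refl = p (diag⇒≡ X _ _ (trans eq (≡⇒diag X _)))

    col-line : ∀ {α β γ δ} (p : α ≢ β) (q : γ ≢ δ) →
               join 𝔸 α β p ≡ join 𝔸 γ δ q → col X α β ≡ col X γ δ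
    col-line p q eq = Equivalence.from (col⇔∥ _ _ _ _ p q) (subst (_∥_ 𝔸 _) eq (∥-refl 𝔸 _))

    -- The lines `αβ` and `γβ` both contain `β` and `β′`, so each is the line `ββ′`, and a line has
    -- only one colour.
    four-cycle : ∀ {α β β′ γ} → β ≢ β′ → col X α β ≡ col X α β′ → col X γ β ≡ col X γ β′ →
                 col X α β ≡ col X γ β
    four-cycle {α} {β} {β′} {γ} β≢β′ αβ≡αβ′ γβ≡γβ′ =
      col-line (apex αβ≡αβ′) (apex γβ≡γβ′) (trans (line αβ≡αβ′) (sym (line γβ≡γβ′)))
      where
      apex : ∀ {δ} → col X δ β ≡ col X δ β′ → δ ≢ β
      apex eq refl = β≢β′ (diag⇒≡ X _ _ (trans (sym eq) (≡⇒diag X _)))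

      line : ∀ {δ} (eq : col X δ β ≡ col X δ β′) → join 𝔸 δ β (apex eq) ≡ join 𝔸 β β′ β≢β′
      line eq = join-uniq 𝔸 β β′ β≢β′ _ (join-I₂ 𝔸 _ _ _) (collinear (apex eq) β≢β′ eq)

    small : SmallIntersections X
    small r s t r≢s* α γ _ = Unique-length≤1 (filter⁺ path? (allFin⁺ N)) λ β∈ β′∈ →
      decidable-stable (_ ≟ _) λ β≢β′ →
      let αβ≡r , βγ≡s = filter-allFin⁻ path? β∈
          αβ′≡r , β′γ≡s = filter-allFin⁻ path? β′∈
          γβ≡s* = trans (star-col X _ _) (cong (star X) βγ≡s)
          γβ′≡s* = trans (star-col X _ _) (cong (star X) β′γ≡s)
      in r≢s* (trans (sym αβ≡r) (trans
           (four-cycle β≢β′ (trans αβ≡r (sym αβ′≡r)) (trans γβ≡s* (sym γβ′≡s*))) γβ≡s*))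
      where
      path? : Decidable (λ β → col X α β ≡ r × col X β γ ≡ s)
      path? β = (col X α β ≟ r) ×-dec (col X β γ ≟ s)

  -- Colour classes of a scheme with small intersection numbers.

  module SmallToAffine (thick : ValencyAtLeast3 X) (small : SmallIntersections X) where

    -- Both `β` and `β′` are counted by `count r s α γ` with `r = col X α β` and `s = col X β γ`.
    -- Two points are too many unless `r` is the transpose of `s`, which is `col X γ β`.
    four-cycle : ∀ {α β β′ γ} → β ≢ β′ → col X α β ≡ col X α β′ → col X γ β ≡ col X γ β′ →
                 col X α β ≡ col X γ β
    four-cycle {α} {β} {β′} {γ} β≢β′ αβ≡αβ′ γβ≡γβ′ =
      trans (decidable-stable (_ ≟ _) λ r≢s* → β≢β′
        (length≤1⇒≡ (small _ _ _ r≢s* α γ refl)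
          (filter-allFin⁺ path? (refl , refl))
          (filter-allFin⁺ path? (sym αβ≡αβ′ , β′γ≡βγ))))
        (sym (star-col X β γ))
      where
      path? : Decidable (λ δ → col X α δ ≡ col X α β × col X δ γ ≡ col X β γ)
      path? δ = (col X α δ ≟ col X α β) ×-dec (col X δ γ ≟ col X β γ)

      β′γ≡βγ : col X β′ γ ≡ col X β γ
      β′γ≡βγ = trans (star-col X γ β′) (trans (cong (star X) (sym γβ≡γβ′)) (sym (star-col X γ β)))

    -- Quotient s t means t ∈ s* s.
    Quotient : Fin (d X) → Fin (d X) → Set
    Quotient s t = ∃ λ α → ∃₂ λ β β′ → col X α β ≡ s × col X α β′ ≡ s × col X β β′ ≡ t

    -- Carrying `α` from the pair `β`, `β′` to the pair `δ`, `δ′` of the same colour gives `α″`; the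
    -- cycle `α″`, `δ`, `α′`, `δ′` then has colours `s` and `s′`.
    quotient-disjoint : ∀ {s s′ t} → t ≢ diag X → Quotient s t → Quotient s′ t → s ≡ s′
    quotient-disjoint t≢1 (α , β , β′ , refl , αβ′ , refl) (α′ , δ , δ′ , refl , α′δ′ , δδ′)
      with transport-path α (sym δδ′)
    ... | α″ , δα″ , α″δ′ = trans (sym α″δ) (four-cycle (≢diag⇒≢ t≢1 δδ′)
            (trans α″δ (sym (trans α″δ′ αβ′))) (sym α′δ′))
      where
      α″δ : col X α″ δ ≡ col X α β
      α″δ = trans (star-col X δ α″) (trans (cong (star X) δα″) (sym (star-col X β α)))

    three-neighbours : ∀ s → s ≢ diag X → ∃ λ α → ∃ λ i → ∃₂ λ j k → i ≢ j × i ≢ k × j ≢ k ×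
                       col X α i ≡ s × col X α j ≡ s × col X α k ≡ s
    three-neighbours s s≢1 with surj X s
    -- Any `α` would do; a pair of colour `s` guarantees that there is a point at all.
    ... | (α , _) , _ = α , 3≤length-filter⇒∃₃ (λ β → col X α β ≟ s) (thick s s≢1 α)

    -- The diagonal is sent to itself so that the choice is a self-map of all colours, as pigeonhole
    -- requires. The last two components keep it apart from the other colours, where
    -- `quotient-disjoint` is available.
    quotient-exists : ∀ s → ∃ λ t → Quotient s t × (s ≢ diag X → t ≢ diag X) ×
                                    (s ≡ diag X → t ≡ diag X)
    quotient-exists s with s ≟ diag X
    ... | yes refl with surj X s
    ...   | (α , _) , _ = diag X , (α , α , α , αα , αα , αα) , (λ s≢1 → s≢1) , (λ s≡1 → s≡1)
      where
      αα : col X α α ≡ diag X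
      αα = ≡⇒diag X α
    quotient-exists s | no s≢1 with three-neighbours s s≢1
    ... | α , i , j , k , i≢j , _ , _ , αi , αj , _ =
      col X i j , (α , i , j , αi , αj , refl) , (λ _ → col≢diag i≢j) ,
      λ s≡1 → contradiction s≡1 s≢1

    quotient : Fin (d X) → Fin (d X)
    quotient s = proj₁ (quotient-exists s)

    quotient-Quotient : ∀ s → Quotient s (quotient s)
    quotient-Quotient s = proj₁ (proj₂ (quotient-exists s))

    quotient≢diag : ∀ {s} → s ≢ diag X → quotient s ≢ diag X
    quotient≢diag {s} = proj₁ (proj₂ (proj₂ (quotient-exists s)))

    quotient≡diag : ∀ {s} → s ≡ diag X → quotient s ≡ diag X
    quotient≡diag {s} = proj₂ (proj₂ (proj₂ (quotient-exists s)))

    quotient-injective : Injective _≡_ _≡_ quotient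
    quotient-injective {s} {s′} eq = by-cases (s ≟ diag X) (s′ ≟ diag X)
      where
      by-cases : Dec (s ≡ diag X) → Dec (s′ ≡ diag X) → s ≡ s′
      by-cases (yes s≡1) (yes s′≡1) = trans s≡1 (sym s′≡1)
      by-cases (yes s≡1) (no s′≢1) =
        contradiction (trans (sym eq) (quotient≡diag s≡1)) (quotient≢diag s′≢1)
      by-cases (no s≢1) _ = quotient-disjoint (quotient≢diag s≢1) (quotient-Quotient s)
        (subst (Quotient s′) (sym eq) (quotient-Quotient s′))

    -- By pigeonhole `t` is `quotient s′` for some `s′`, so it lies in both s′* s′ and s* s, and
    -- disjointness forces `s′` to be `s`.
    quotient-unique : ∀ {s t} → t ≢ diag X → Quotient s t → t ≡ quotient s
    quotient-unique {s} {t} t≢1 q with injective⇒surjective quotient-injective t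
    ... | s′ , eq = trans (sym eq) (cong quotient
            (quotient-disjoint t≢1 (subst (Quotient s′) eq (quotient-Quotient s′)) q))

    quotient-fixes : ∀ {s} → s ≢ diag X → quotient s ≡ s
    quotient-fixes {s} s≢1 with three-neighbours s s≢1
    ... | α , i , j , k , i≢j , i≢k , j≢k , αi , αj , αk =
      -- Valency three is used in full here: `j` and `k` are opposite corners of the cycle through
      -- `i` and `α`.
      trans (sym ij) (trans (four-cycle j≢k (trans ij (sym ik)) (trans αj (sym αk))) αj)
      where
      ij : col X i j ≡ quotient s
      ij = quotient-unique (col≢diag i≢j) (α , i , j , αi , αj , refl)

      ik : col X i k ≡ quotient s
      ik = quotient-unique (col≢diag i≢k) (α , i , k , αi , αk , refl)

    col-closed : ∀ {α β β′ s} → β ≢ β′ → col X α β ≡ s → col X α β′ ≡ s → col X β β′ ≡ s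
    col-closed {α} {β} {β′} β≢β′ αβ αβ′ =
      trans (quotient-unique (col≢diag β≢β′) (α , β , β′ , αβ , αβ′ , refl))
            (quotient-fixes s≢1)
      where
      s≢1 : _ ≢ diag X
      s≢1 s≡1 = β≢β′ (trans (sym (diag⇒≡ X _ _ (trans αβ s≡1))) (diag⇒≡ X _ _ (trans αβ′ s≡1)))

    -- For two distinct `s`-neighbours `i`, `j` of one point, closure gives colour `s` to the pair
    -- in either order.
    star-trivial : ∀ {s} → s ≢ diag X → star X s ≡ s
    star-trivial {s} s≢1 with three-neighbours s s≢1
    ... | α , i , j , k , i≢j , _ , _ , αi , αj , _ =
      trans (cong (star X) (sym (col-closed i≢j αi αj)))
        (trans (sym (star-col X i j)) (col-closed (i≢j ∘ sym) αj αi))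

    col-symmetric : ∀ α β → col X β α ≡ col X α β
    col-symmetric α β with α ≟ β
    ... | yes refl = refl
    ... | no α≢β = trans (star-col X α β) (star-trivial (col≢diag α≢β))

    -- Lines as equivalence classes of a fixed direction.

    _~[_]_ : Fin N → Fin (d X) → Fin N → Set
    x ~[ s ] y = x ≡ y ⊎ col X x y ≡ s

    _~[_]?_ : ∀ x s y → Dec (x ~[ s ] y)
    x ~[ s ]? y = (x ≟ y) ⊎-dec (col X x y ≟ s)

    ~-sym : ∀ {s x y} → x ~[ s ] y → y ~[ s ] x
    ~-sym (inj₁ x≡y) = inj₁ (sym x≡y)
    ~-sym (inj₂ xy) = inj₂ (trans (col-symmetric _ _) xy)

    ~-trans : ∀ {s x y z} → x ~[ s ] y → y ~[ s ] z → x ~[ s ] z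
    ~-trans (inj₁ refl) y~z = y~z
    ~-trans x~y (inj₁ refl) = x~y
    ~-trans {x = x} {z = z} (inj₂ xy) (inj₂ yz) with x ≟ z
    ... | yes x≡z = inj₁ x≡z
    ... | no x≢z = inj₂ (col-closed x≢z (trans (col-symmetric _ _) xy) yz)

    -- The first point of the class of x, serving as its canonical representative.
    rep : Fin (d X) → Fin N → Fin N
    rep s x = fromMaybe x (head (filter (x ~[ s ]?_) (allFin N)))

    ~-rep : ∀ s x → x ~[ s ] rep s x
    ~-rep s x = filter-allFin⁻ (x ~[ s ]?_)
      (fromMaybe-head-∈ x (filter-allFin⁺ (x ~[ s ]?_) (inj₁ refl)))

    rep-cong : ∀ {s x y} → x ~[ s ] y → rep s x ≡ rep s y
    rep-cong {s} {x} {y} x~y = trans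
      -- The defaults `x` and `y` differ, but neither is reached: the list contains `x`.
      (fromMaybe-head-irrelevant x y (filter-allFin⁺ (x ~[ s ]?_) (inj₁ refl)))
      (cong (fromMaybe y ∘ head)
        (filter-≐ (x ~[ s ]?_) (y ~[ s ]?_) (~-trans (~-sym x~y) , ~-trans x~y) (allFin N)))

    rep-reflects : ∀ {s x y} → rep s x ≡ rep s y → x ~[ s ] y
    rep-reflects {s} {x} {y} eq =
      ~-trans (~-rep s x) (subst (_~[ s ] y) (sym eq) (~-sym (~-rep s y)))

    -- A class is encoded by its direction and canonical representative, not as a predicate, because
    -- the axioms ask for propositional equality of lines.
    record DirectedLine : Set where
      field
        direction : Fin (d X)
        base      : Fin N
        proper    : direction ≢ diag X
        canonical : rep direction base ≡ base

    open DirectedLine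

    _∈ˡ_ : Fin N → DirectedLine → Set
    x ∈ˡ l = rep (direction l) x ≡ base l

    lineThrough : ∀ (x : Fin N) (s : Fin (d X)) → s ≢ diag X → DirectedLine
    lineThrough x s s≢1 = record
      { direction = s ; base = rep s x ; proper = s≢1
      ; canonical = sym (rep-cong (~-rep s x)) }

    line-unique : ∀ {l m x} → x ∈ˡ l → x ∈ˡ m → direction l ≡ direction m → l ≡ m
    line-unique {l} {m} x∈l x∈m l∥m = extensional l∥m
      (trans (sym x∈l) (trans (cong (λ s → rep s _) l∥m) x∈m))
      where
      extensional : ∀ {l m} → direction l ≡ direction m → base l ≡ base m → l ≡ m
      extensional {record { canonical = u }} {record { canonical = v }} refl refl
        -- Proofs of `proper` are negations and agree definitionally; only the proofs of `canonical`
        -- must be identified.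
        rewrite Decidable⇒UIP.≡-irrelevant _≟_ u v = refl

    joinLine : (x y : Fin N) → x ≢ y → DirectedLine
    joinLine x y x≢y = lineThrough x (col X x y) (col≢diag x≢y)

    direction-unique : ∀ {x y} l → x ≢ y → x ∈ˡ l → y ∈ˡ l → direction l ≡ col X x y
    direction-unique l x≢y x∈l y∈l with rep-reflects (trans x∈l (sym y∈l))
    ... | inj₁ x≡y = contradiction x≡y x≢y
    ... | inj₂ xy = sym xy

    two-points-on : ∀ l → ∃₂ λ x y → x ≢ y × x ∈ˡ l × y ∈ˡ l
    two-points-on l with 1≤length-filter⇒∃ (λ y → col X (base l) y ≟ direction l)
                           (≤-trans (s≤s z≤n) (thick (direction l) (proper l) (base l)))
    ... | y , by = base l , y , ≢diag⇒≢ (proper l) by , canonical l ,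
                   trans (rep-cong (~-sym (inj₂ by))) (canonical l)

    -- The affine space and its scheme.

    affineSpace : AffineSpace N
    affineSpace = record
      { Line = DirectedLine
      ; _I_ = _∈ˡ_
      ; _∥_ = λ l m → direction l ≡ direction m
      ; join = joinLine
      ; join-I₁ = λ _ _ _ → refl
      ; join-I₂ = λ x y _ → rep-cong (inj₂ (col-symmetric x y))
      ; join-uniq = λ x y x≢y l x∈l y∈l →
          line-unique x∈l refl (direction-unique l x≢y x∈l y∈l)
      ; two-points = two-points-on
      ; ∥-refl = λ _ → refl
      ; ∥-sym = λ _ _ → sym
      ; ∥-trans = λ _ _ _ → trans
      ; playfair-∃ = λ x l → lineThrough x (direction l) (proper l) , refl , refl
      ; playfair-! = λ _ _ _ _ x∈m m∥l x∈m′ m′∥l → line-unique x∈m x∈m′ (trans m∥l (sym m′∥l))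
      ; triangle = triangle-axiom
      }
      where
      triangle-axiom : ∀ a b c a′ b′ (ab : a ≢ b) (ac : a ≢ c) (bc : b ≢ c) (ab′ : a′ ≢ b′) →
        ¬ (c ∈ˡ joinLine a b ab) → col X a b ≡ col X a′ b′ →
        ∀ m₁ m₂ → a′ ∈ˡ m₁ → direction m₁ ≡ col X a c → b′ ∈ˡ m₂ → direction m₂ ≡ col X b c →
        ∃ λ x → x ∈ˡ m₁ × x ∈ˡ m₂
      triangle-axiom a b c a′ b′ _ _ _ _ _ ab≡a′b′ m₁ m₂ a′∈m₁ m₁∥ac b′∈m₂ m₂∥bc
        -- The copy `x` of `c` over the pair `a′`, `b′` sees `a′` in the direction of `m₁` and `b′`
        -- in that of `m₂`.
        with transport-path c ab≡a′b′
      ... | x , a′x , xb′ = x ,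
        trans (rep-cong (~-sym (inj₂ (trans a′x (sym m₁∥ac))))) a′∈m₁ ,
        trans (rep-cong (inj₂ (trans xb′ (trans (col-symmetric b c) (sym m₂∥bc))))) b′∈m₂

    -- The direction of a join is by definition the colour of the pair, so both sides of the
    -- equivalence are the same equation.
    affine : IsAffineScheme X
    affine = affineSpace , λ _ _ _ _ _ _ → mk⇔ (λ eq → eq) (λ eq → eq)

theorem7p4 : (N : ℕ) (X : Scheme N) → ValencyAtLeast3 X →
    IsAffineScheme X ⇔ SmallIntersections X
theorem7p4 N X thick = mk⇔
  (λ (𝔸 , col⇔∥) → AffineToSmall.small X 𝔸 col⇔∥)
  (SmallToAffine.affine X thick)
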